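{- $sat(K_3^2,C_5)=6$, and $sat(K_3^n,C_5)=3n+1$ for every $n\ge 3$.
   Context: All graphs are finite, simple and undirected. $K_k^n$ denotes the complete $k$-partite graph with exactly $n$ vertices in each of its $k$ parts. $C_5$ is the cycle on $5$ vertices. For graphs $G$ and $F$, a spanning subgraph $H$ of $G$ is $F$-saturated relative to $G$ if $H$ contains no copy of $F$ but $H+e$ contains a copy of $F$ for every $e\in E(G)\setminus E(H)$; $sat(G,F)$ is the minimum number of edges of a graph that is $F$-saturated relative to $G$. -}

module Defs where

open import Data.Nat using (ℕ; zero; suc; _+_; _*_; _≤_)
open import Data.Nat.DivMod using (_%_)
open import Data.Bool using (Bool; true; false; _∨_; _∧_; if_then_else_)
open import Data.Fin using (Fin; toℕ; quotient; _<?_)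
open import Data.Fin.Properties renaming (_≟_ to _≟ᶠ_)
open import Data.List using (List; map)
open import Data.Nat.ListAction using (sum)
open import Data.List using () renaming (allFin to allFinL)
open import Data.Product using (Σ; _×_; ∃-syntax)
open import Relation.Nullary using (¬_; does)
open import Relation.Binary.PropositionalEquality using (_≡_; _≢_)
open import Function.Definitions using (Injective)

Graph : ℕ → Set
Graph N = Fin N → Fin N → Bool

record IsSimple {N : ℕ} (A : Graph N) : Set where
  field
    sym     : ∀ u v → A u v ≡ A v u
    irrefl  : ∀ u → A u u ≡ false

edges : {N : ℕ} → Graph N → ℕ
edges {N} A = sum (map (λ u → sum (map (λ v →
  if does (u <? v) ∧ A u v then 1 else 0) (allFinL N))) (allFinL N))

_⊆G_ : {N : ℕ} → Graph N → Graph N → Set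
H ⊆G G = ∀ u v → H u v ≡ true → G u v ≡ true

ContainsCopy : {k N : ℕ} → Graph k → Graph N → Set
ContainsCopy {k} {N} F H =
  Σ (Fin k → Fin N) λ f → Injective _≡_ _≡_ f × (∀ i j → F i j ≡ true → H (f i) (f j) ≡ true)

addEdge : {N : ℕ} → Graph N → Fin N → Fin N → Graph N
addEdge H u v x y =
  H x y ∨ (does (x ≟ᶠ u) ∧ does (y ≟ᶠ v)) ∨ (does (x ≟ᶠ v) ∧ does (y ≟ᶠ u))

record Saturated {k N : ℕ} (G : Graph N) (F : Graph k) (H : Graph N) : Set where
  field
    simple   : IsSimple H
    spanning : H ⊆G G
    free     : ¬ ContainsCopy F H
    maximal  : ∀ u v → G u v ≡ true → H u v ≡ false → ContainsCopy F (addEdge H u v)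

SatEq : {k N : ℕ} → Graph N → Graph k → ℕ → Set
SatEq {k} {N} G F m =
  (Σ (Graph N) λ H → Saturated G F H × edges H ≡ m) ×
  (∀ H → Saturated G F H → m ≤ edges H)

-- The complete 3-partite graph K_3^n on Fin (3 * n); vertex v lies in part (quotient {3} n v).
K3 : (n : ℕ) → Graph (3 * n)
K3 n u v = Data.Bool.not (does (quotient {3} n u ≟ᶠ quotient {3} n v))

C5 : Graph 5
C5 i j = does (toℕ j Data.Nat.≟ (suc (toℕ i) % 5)) ∨ does (toℕ i Data.Nat.≟ (suc (toℕ j) % 5))

{-# OPTIONS --safe #-}
module Submission where

-- Lower bound.  A saturated H is connected, since two nonadjacent vertices of different parts are joined by
-- a path of length 4.  If S is a connected subgraph and every edge outside S is a bridge, such a path between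
-- vertices of S stays in S; hence vertices of S that S joins neither by an edge nor by a path of length 4 lie
-- in the same part.  Some path x y z meets all three parts; if H were a tree, S = x y z would be contradictory,
-- so H has at least 3n edges.  If H has exactly 3n edges, then completing x y z by an edge or by a path of
-- length 4 from x to z gives a triangle or a hexagon (to which a further vertex is attached when n ≥ 3), or
-- a triangle or a 4-cycle with a pendant vertex.  A cycle of length 3, 4 or 6 with a pendant vertex is always
-- contradictory as S.
--
-- Connectedness is expressed by labellings: a graph is connected when every labelling constant along edges is
-- constant.  This makes "removing an edge of a cycle keeps the graph connected" a chain of equalities.
--
-- Upper bound.  A hexagon for n = 2; for n ≥ 3 two triangles sharing an edge, with trees attached, whose
-- pendant vertices are repeated according to n.

open import Defs
open import Data.Nat using (ℕ; _*_; _+_; _≤_)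
open import Data.Product using (_×_)

open import Data.Nat using (zero; suc; z≤n; s≤s; _<_; _≤?_)
import Data.Nat as ℕ
import Data.Nat.Properties as ℕₚ
open import Data.Nat.ListAction using (sum)
open import Data.Nat.GeneralisedArithmetic using (iterate)
open import Data.Bool using (Bool; true; false; _∨_; _∧_; not; if_then_else_)
import Data.Bool.Properties as 𝔹
open import Data.Fin using (Fin; zero; suc; toℕ; fromℕ; inject₁; opposite; punchIn; punchOut;
  quotient; remainder; remQuot; combine; _<?_)
open import Data.Fin.Properties using (_≟_; any?; all?; injective⇒≤; punchOut-cong; punchOut-punchIn; punchInᵢ≢i;
  suc-injective; inject₁-injective; toℕ-injective; toℕ-inject₁; fromℕ≢inject₁; <-cmp; ¬∀⟶∃¬;
  remQuot-combine; combine-remQuot)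
open import Data.List using (List; []; _∷_; length; map; tabulate; allFin)
open import Data.List.Properties using (map-tabulate; tabulate-cong; length-map; length-tabulate)
open import Data.List.Membership.Propositional using (lose)
open import Data.List.Membership.Propositional.Properties using (∈-allFin)
open import Data.List.Relation.Unary.Any using (Any; here; there)
open import Data.List.Relation.Unary.Any.Properties using (map⁺)
open import Data.Product using (_,_; proj₁; proj₂; ∃; ∃₂)
open import Data.Sum using (_⊎_; inj₁; inj₂; [_,_]; map₂)
open import Data.Empty using (⊥)
open import Data.Fin.Induction using (>-weakInduction)
open import Data.Vec.Functional using () renaming (_∷_ to _∷ᵛ_; [] to []ᵛ)
open import Function using (_∘_; id; case_of_; mk⇔)
open import Function.Definitions using (Injective)
open import Relation.Binary using (tri<; tri≈; tri>)
open import Relation.Nullary using (¬_; Dec; yes; no; does; contradiction)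
open import Relation.Nullary.Decidable using (_×-dec_; _⊎-dec_; ¬?; _→-dec_; dec-true; dec-false;
  does-⇔; from-yes; from-no; True; toWitness; decidable-stable)
open import Relation.Binary.PropositionalEquality using (_≡_; _≢_; refl; sym; trans; cong; cong₂; subst)

pattern 0′ = zero
pattern 1′ = suc zero
pattern 2′ = suc 1′
pattern 3′ = suc 2′
pattern 4′ = suc 3′
pattern 5′ = suc 4′
pattern 6′ = suc 5′

private variable
  k l m n N : ℕ
  X : Set

Inj : {A B : Set} → (A → B) → Set
Inj = Injective _≡_ _≡_

true≢false : true ≢ false
true≢false ()

≢true⇒false : ∀ {b} → b ≢ true → b ≡ false
≢true⇒false {true}  h = contradiction refl h
≢true⇒false {false} _ = refl

witness : ∀ {P : Set} (P? : Dec P) → does P? ≡ true → P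
witness (yes p) _ = p

-- Edge counting

SameEdge : Fin N → Fin N → Fin N → Fin N → Set
SameEdge a b x y = (x ≡ a × y ≡ b) ⊎ (x ≡ b × y ≡ a)

sameEdge? : (a b x y : Fin N) → Dec (SameEdge a b x y)
sameEdge? a b x y = ((x ≟ a) ×-dec (y ≟ b)) ⊎-dec ((x ≟ b) ×-dec (y ≟ a))

sameEdge-flip : {a b x y : Fin N} → SameEdge a b x y → SameEdge a b y x
sameEdge-flip (inj₁ (p , q)) = inj₂ (q , p)
sameEdge-flip (inj₂ (p , q)) = inj₁ (q , p)

sameEdge-swap : {a b x y : Fin N} → SameEdge a b x y → SameEdge b a x y
sameEdge-swap (inj₁ p) = inj₂ p
sameEdge-swap (inj₂ p) = inj₁ p

delete : Graph N → Fin N → Fin N → Graph N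
delete A a b x y = A x y ∧ not (does (sameEdge? a b x y))

module _ {A : Graph N} {a b x y : Fin N} where

  delete-keep : A x y ≡ true → ¬ SameEdge a b x y → delete A a b x y ≡ true
  delete-keep h ne rewrite h | dec-false (sameEdge? a b x y) ne = refl

  delete-≡ : ¬ SameEdge a b x y → delete A a b x y ≡ A x y
  delete-≡ ne rewrite dec-false (sameEdge? a b x y) ne = 𝔹.∧-identityʳ (A x y)

  delete-gone : SameEdge a b x y → delete A a b x y ≡ false
  delete-gone e rewrite dec-true (sameEdge? a b x y) e = 𝔹.∧-zeroʳ (A x y)

  delete-⊆ : delete A a b x y ≡ true → A x y ≡ true
  delete-⊆ h = 𝔹.∧-conicalˡ (A x y) _ h

  delete-≢ : delete A a b x y ≡ true → ¬ SameEdge a b x y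
  delete-≢ h e = true≢false (trans (sym h) (delete-gone e))

delete-simple : {A : Graph N} (a b : Fin N) → IsSimple A → IsSimple (delete A a b)
delete-simple {A = A} a b sA = record
  { sym    = λ u v → cong₂ (λ p q → p ∧ not q) (IsSimple.sym sA u v)
                       (does-⇔ (mk⇔ sameEdge-flip sameEdge-flip)
                         (sameEdge? a b u v) (sameEdge? a b v u))
  ; irrefl = λ u → cong (_∧ _) (IsSimple.irrefl sA u)
  }

sum-cong : {f g : Fin N → ℕ} → (∀ i → f i ≡ g i) → sum (map f (allFin N)) ≡ sum (map g (allFin N))
sum-cong {f = f} {g} h =
  cong sum (trans (map-tabulate id f) (trans (tabulate-cong h) (sym (map-tabulate id g))))

sum-tabulate-suc : (f g : Fin N → ℕ) (x : Fin N) → (∀ i → i ≢ x → f i ≡ g i) → f x ≡ suc (g x) →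
                   sum (tabulate f) ≡ suc (sum (tabulate g))
sum-tabulate-suc f g zero off at =
  cong₂ _+_ at (cong sum (tabulate-cong (λ i → off (suc i) λ ())))
sum-tabulate-suc f g (suc x) off at =
  trans (cong₂ _+_ (off zero λ ()) (sum-tabulate-suc (f ∘ suc) (g ∘ suc) x (λ i ne → off (suc i) (ne ∘ suc-injective)) at))
        (ℕₚ.+-suc (g zero) _)

sum-suc : (f g : Fin N → ℕ) (x : Fin N) → (∀ i → i ≢ x → f i ≡ g i) → f x ≡ suc (g x) →
          sum (map f (allFin N)) ≡ suc (sum (map g (allFin N)))
sum-suc f g x off at =
  trans (cong sum (map-tabulate id f))
        (trans (sum-tabulate-suc f g x off at) (cong (suc ∘ sum) (sym (map-tabulate id g))))

edges-cong : {A B : Graph N} → (∀ u v → A u v ≡ B u v) → edges A ≡ edges B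
edges-cong h = sum-cong λ u → sum-cong λ v → cong (λ e → if does (u <? v) ∧ e then 1 else 0) (h u v)

-- Each edge is counted once, at its increasing ordered pair, so only the summand at (`a`, `b`)
-- changes; the pair (`b`, `a`) counts 0 before and after.
edges-delete-< : {A : Graph N} {a b : Fin N} → toℕ a < toℕ b → A a b ≡ true →
                 edges A ≡ suc (edges (delete A a b))
edges-delete-< {A = A} {a} {b} a<b h =
  sum-suc _ _ a (λ u u≢a → sum-cong λ v → other u v (u≢a ∘ proj₁))
    (sum-suc _ _ b (λ v v≢b → other a v (v≢b ∘ proj₂)) at-ab)
  where
  indicator : Graph _ → Fin _ → Fin _ → ℕ
  indicator B u v = if does (u <? v) ∧ B u v then 1 else 0
  other : ∀ u v → ¬ (u ≡ a × v ≡ b) → indicator A u v ≡ indicator (delete A a b) u v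
  other u v ne = case sameEdge? a b u v of λ
    { (yes (inj₁ e)) → contradiction e ne
    ; (yes (inj₂ (refl , refl))) → trans (reversed A) (sym (reversed (delete A a b)))
    ; (no ne') → cong (λ e → if does (u <? v) ∧ e then 1 else 0) (sym (delete-≡ {A = A} ne')) }
    where
    reversed : ∀ B → indicator B b a ≡ 0
    reversed B rewrite dec-false (b <? a) (ℕₚ.<-asym a<b) = refl
  at-ab : indicator A a b ≡ suc (indicator (delete A a b) a b)
  at-ab rewrite dec-true (a <? b) a<b | delete-gone {A = A} {a} {b} {a} {b} (inj₁ (refl , refl)) | h = refl

edges-delete : {A : Graph N} {a b : Fin N} → IsSimple A → A a b ≡ true →
               edges A ≡ suc (edges (delete A a b))
edges-delete {A = A} {a} {b} sA h with <-cmp a b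
... | tri< a<b _ _  = edges-delete-< {A = A} a<b h
... | tri≈ _ refl _ = contradiction (trans (sym h) (IsSimple.irrefl sA a)) true≢false
... | tri> _ _ b<a  =
  trans (edges-delete-< {A = A} b<a (trans (IsSimple.sym sA b a) h))
        (cong suc (edges-cong λ u v → cong (λ e → A u v ∧ not e)
          (𝔹.∨-comm (does ((u ≟ b) ×-dec (v ≟ a))) _)))

-- Connectivity

Compatible : Graph N → (Fin N → X) → Set
Compatible A f = ∀ u v → A u v ≡ true → f u ≡ f v

Connected : Graph N → Set₁
Connected {N} A = {X : Set} (f : Fin N → X) → Compatible A f → ∀ u v → f u ≡ f v

module _ {p q : Fin (suc m)} (p≢q : p ≢ q) where

  -- Sends `p` to where `q` goes, then closes the gap left at `p`.
  merge : Fin (suc m) → Fin m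
  merge i with p ≟ i
  ... | yes _  = punchOut p≢q
  ... | no p≢i = punchOut p≢i

  merge-≡ : merge p ≡ merge q
  merge-≡ with p ≟ p | p ≟ q
  ... | no p≢p | _       = contradiction refl p≢p
  ... | yes _  | yes p≡q = contradiction p≡q p≢q
  ... | yes _  | no _    = punchOut-cong p refl

  merge-punchIn : ∀ j → merge (punchIn p j) ≡ j
  merge-punchIn j with p ≟ punchIn p j
  ... | yes e = contradiction (sym e) (punchInᵢ≢i p j)
  ... | no _  = trans (punchOut-cong p refl) (punchOut-punchIn p)

-- A labelling constant on components that attains all `M` labels, so `M` is at most the number of
-- components; `section` witnesses surjectivity by representatives.
record Quotient (A : Graph N) (M : ℕ) : Set where
  field
    label   : Fin N → Fin M
    section : Fin M → Fin N
    isSect  : ∀ j → label (section j) ≡ j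
    compat  : Compatible A label

anyEdge? : (A : Graph N) → Dec (∃₂ λ a b → A a b ≡ true)
anyEdge? A = any? λ a → any? λ b → A a b 𝔹.≟ true

-- Each edge put back identifies at most two labels.
quotient-size : ∀ e (A : Graph N) → IsSimple A → edges A ≡ e → ∃ λ M → Quotient A M × N ≤ M + e
quotient-size {N} e A sA eq with anyEdge? A
... | no none = N , record
        { label = id ; section = id ; isSect = λ _ → refl
        ; compat = λ u v h → contradiction (u , v , h) none } , ℕₚ.m≤m+n N e
quotient-size {N} zero A sA eq | yes (a , b , h) =
  contradiction (trans (sym eq) (edges-delete sA h)) λ ()
quotient-size {N} (suc e) A sA eq | yes (a , b , h)
  with quotient-size e (delete A a b) (delete-simple a b sA)
         (ℕₚ.suc-injective (trans (sym (edges-delete sA h)) eq))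
... | M , Q , bound with Quotient.label Q a ≟ Quotient.label Q b
... | yes same = M , record
        { label = label ; section = section ; isSect = isSect
        ; compat = λ u v uv → case sameEdge? a b u v of λ
            { (yes (inj₁ (refl , refl))) → same
            ; (yes (inj₂ (refl , refl))) → sym same
            ; (no ne) → compat u v (delete-keep {A = A} uv ne) } }
        , ℕₚ.≤-trans bound (ℕₚ.+-monoʳ-≤ M (ℕₚ.n≤1+n e))
  where open Quotient Q
... | no differ with M
... | zero = case Quotient.label Q a of λ ()
... | suc M' = M' , record
        -- New label `j` stands for the old label `punchIn (label a) j`, which differs from
        -- `label a` and keeps its representative.
        { label = merge differ ∘ label ; section = section ∘ punchIn (label a)
        ; isSect = λ j → trans (cong (merge differ) (isSect _)) (merge-punchIn differ j)
        ; compat = λ u v uv → case sameEdge? a b u v of λ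
            { (yes (inj₁ (refl , refl))) → merge-≡ differ
            ; (yes (inj₂ (refl , refl))) → sym (merge-≡ differ)
            ; (no ne) → cong (merge differ) (compat u v (delete-keep {A = A} uv ne)) } }
        , ℕₚ.≤-trans bound (ℕₚ.≤-reflexive (sym (ℕₚ.+-suc M' e)))
  where open Quotient Q

connected⇒≤ : {A : Graph N} → IsSimple A → Connected A → N ≤ suc (edges A)
connected⇒≤ {A = A} sA con with quotient-size (edges A) A sA refl
... | M , Q , bound = ℕₚ.≤-trans bound (ℕₚ.+-monoˡ-≤ (edges A) M≤1)
  where
  open Quotient Q
  M≤1 : M ≤ 1
  -- Connectedness makes all labels equal, so the constant map to `Fin 1` is injective.
  M≤1 = injective⇒≤ {f = λ _ → zero} λ {i} {j} _ →
    trans (sym (isSect i)) (trans (con label compat _ _) (isSect j))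

-- If the ends of the deleted edge are still forced to share a label, a labelling compatible with
-- the rest is compatible with all of `A`.
connected-delete : {A : Graph N} {a b : Fin N} → Connected A →
  ({X : Set} (f : Fin N → X) → Compatible (delete A a b) f → f a ≡ f b) → Connected (delete A a b)
connected-delete {A = A} {a} {b} con join f cf = con f λ u v uv →
  case sameEdge? a b u v of λ
    { (yes (inj₁ (refl , refl))) → join f cf
    ; (yes (inj₂ (refl , refl))) → sym (join f cf)
    ; (no ne) → cf u v (delete-keep {A = A} uv ne) }

chain : (g : Fin (suc l) → X) → (∀ s → g (inject₁ s) ≡ g (suc s)) → ∀ i → g zero ≡ g i
chain g steps zero = refl
chain {suc l} g steps (suc i) = trans (steps zero) (chain (g ∘ suc) (steps ∘ suc) i)

-- In a closed chain of equalities, any one link follows by going round the other way.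
chain-gap : (g : Fin (suc l) → X) (t : Fin l) → g zero ≡ g (fromℕ l) →
            (∀ s → s ≢ t → g (inject₁ s) ≡ g (suc s)) → g (inject₁ t) ≡ g (suc t)
chain-gap {suc l} g zero ends steps =
  trans ends (sym (chain (g ∘ suc) (λ s → steps (suc s) λ ()) (fromℕ l)))
chain-gap {suc l} g (suc t) ends steps =
  chain-gap (g ∘ suc) t (trans (sym (steps zero λ ())) ends) λ s ne → steps (suc s) (ne ∘ suc-injective)

-- Paths, and subgraphs all of whose outside edges are bridges

Symmetric : Graph N → Set
Symmetric A = ∀ u v → A u v ≡ true → A v u ≡ true

record Path (H : Graph N) (l : ℕ) (u v : Fin N) : Set where
  field
    at    : Fin (suc l) → Fin N
    inj   : Inj at
    first : at zero ≡ u
    last  : at (fromℕ l) ≡ v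
    step  : ∀ t → H (at (inject₁ t)) (at (suc t)) ≡ true

-- Rules out that a path runs through one edge in both directions.
inject₁-suc-acyclic : (s t : Fin l) → inject₁ s ≡ suc t → suc s ≢ inject₁ t
inject₁-suc-acyclic s t e e' = ℕₚ.<-asym s<t t<s
  where
  s<t : toℕ s < toℕ t
  s<t = ℕₚ.≤-reflexive (trans (cong toℕ e') (toℕ-inject₁ t))
  t<s : toℕ t < toℕ s
  t<s = ℕₚ.≤-reflexive (trans (cong toℕ (sym e)) (toℕ-inject₁ s))

path-edges-distinct : {at : Fin (suc l) → Fin N} → Inj at → ∀ s t → s ≢ t →
  ¬ SameEdge (at (inject₁ t)) (at (suc t)) (at (inject₁ s)) (at (suc s))
path-edges-distinct inj s t s≢t (inj₁ (_ , e)) = s≢t (suc-injective (inj e))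
path-edges-distinct inj s t s≢t (inj₂ (e , e')) = inject₁-suc-acyclic s t (inj e) (inj e')

Image : Graph k → (Fin k → Fin N) → Fin N → Fin N → Set
Image S φ a b = ∃₂ λ i j → φ i ≡ a × φ j ≡ b × S i j ≡ true

image? : (S : Graph k) (φ : Fin k → Fin N) → ∀ a b → Dec (Image S φ a b)
image? S φ a b = any? λ i → any? λ j → (φ i ≟ a) ×-dec ((φ j ≟ b) ×-dec (S i j 𝔹.≟ true))

-- A path `i a b c j` of length 4. Tests are interleaved with the quantifiers so that the exhaustive
-- search prunes early.
ShortPath : Graph k → Fin k → Fin k → Set
ShortPath S i j = ∃ λ a → S i a ≡ true × ∃ λ b → S a b ≡ true × i ≢ b ×
                  ∃ λ c → S b c ≡ true × i ≢ c × a ≢ c × S c j ≡ true × a ≢ j × b ≢ j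

shortPath? : (S : Graph k) → ∀ i j → Dec (ShortPath S i j)
shortPath? S i j = any? λ a → (S i a 𝔹.≟ true) ×-dec any? λ b → (S a b 𝔹.≟ true) ×-dec ¬? (i ≟ b) ×-dec
                   any? λ c → (S b c 𝔹.≟ true) ×-dec ¬? (i ≟ c) ×-dec ¬? (a ≟ c) ×-dec (S c j 𝔹.≟ true)
                     ×-dec ¬? (a ≟ j) ×-dec ¬? (b ≟ j)

record Bridged (H : Graph N) (S : Graph k) (φ : Fin k → Fin N) : Set₁ where
  field
    S-sym  : Symmetric S
    S-conn : Connected S
    φ-inj  : Inj φ
    φ-hom  : ∀ i j → S i j ≡ true → H (φ i) (φ j) ≡ true
    H-conn : Connected H
    bridge : ∀ a b → H a b ≡ true → ¬ Image S φ a b → ¬ Connected (delete H a b)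

  -- A path edge outside S would be bypassed by the rest of the path and a route through S.
  confined : ∀ {i j} (P : Path H l (φ i) (φ j)) t → Image S φ (Path.at P (inject₁ t)) (Path.at P (suc t))
  confined {i = i} {j} P t = decidable-stable (image? S φ _ _) λ outside →
    bridge _ _ (step t) outside (connected-delete {A = H} H-conn λ f cf →
      chain-gap (f ∘ at) t
        (trans (cong f first) (trans (S-conn (f ∘ φ) (λ x y xy → cf (φ x) (φ y) (delete-keep {A = H} (φ-hom x y xy)
          λ { (inj₁ (e , e')) → outside (x , y , e , e' , xy)
            ; (inj₂ (e , e')) → outside (y , x , e' , e , S-sym x y xy) })) i j) (cong f (sym last))))
        λ s s≢t → cf _ _ (delete-keep {A = H} (step s) (path-edges-distinct inj s t s≢t)))
    where open Path P

  -- An edge is a path with one step, so `confined` applies.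
  confined-edge : ∀ i j → i ≢ j → H (φ i) (φ j) ≡ true → S i j ≡ true
  confined-edge i j i≢j h with confined {l = 1} {i} {j} record
      { at = λ { zero → φ i ; (suc zero) → φ j }
      ; inj = λ { {zero} {zero} _ → refl ; {suc zero} {suc zero} _ → refl
                ; {zero} {suc zero} e → contradiction (φ-inj e) i≢j
                ; {suc zero} {zero} e → contradiction (φ-inj (sym e)) i≢j }
      ; first = refl ; last = refl ; step = λ { zero → h } } zero
  ... | x , y , e , e' , xy rewrite φ-inj e | φ-inj e' = xy

  confined-path : ∀ i j → Path H 4 (φ i) (φ j) → ShortPath S i j
  confined-path i j P
    with a₀ , a  , p₀ , q₀ , s₀ ← confined P zero
       | a₁ , b  , p₁ , q₁ , s₁ ← confined P (suc zero)
       | a₂ , c  , p₂ , q₂ , s₂ ← confined P (suc (suc zero))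
       | a₃ , b₃ , p₃ , q₃ , s₃ ← confined P (suc (suc (suc zero)))
    -- Each step of `P` comes from an edge of `S`; injectivity of `φ` glues these four edges at
    -- their shared ends.
    with refl ← φ-inj (trans p₀ (Path.first P)) | refl ← φ-inj (trans p₁ (sym q₀))
       | refl ← φ-inj (trans p₂ (sym q₁)) | refl ← φ-inj (trans p₃ (sym q₂))
       | refl ← φ-inj (trans q₃ (Path.last P))
    = a , s₀ , b , s₁ , apart p₀ q₁ (λ ()) , c , s₂ , apart p₀ q₂ (λ ()) , apart q₀ q₂ (λ ()) , s₃
    , apart q₀ q₃ (λ ()) , apart q₁ q₃ (λ ())
    where
    open Path P
    apart : ∀ {x y s t} → φ x ≡ at s → φ y ≡ at t → s ≢ t → x ≢ y
    apart e e' s≢t refl = s≢t (inj (trans (sym e) e'))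

-- Pans

pathGraph : (k : ℕ) → Graph k
pathGraph k i j = does (toℕ j ℕ.≟ suc (toℕ i)) ∨ does (toℕ i ℕ.≟ suc (toℕ j))

-- The cycle 1, …, 2 + m with a pendant vertex 0 attached to 1.
pan : (m : ℕ) → Graph (3 + m)
pan m = addEdge (pathGraph (3 + m)) (suc zero) (fromℕ (2 + m))

∨-true : ∀ {a b} → a ∨ b ≡ true → a ≡ true ⊎ b ≡ true
∨-true {true}  _ = inj₁ refl
∨-true {false} h = inj₂ h

∨-trueʳ : ∀ {a b} → b ≡ true → a ∨ b ≡ true
∨-trueʳ {a} refl = 𝔹.∨-zeroʳ a

∨-trueˡ : ∀ {a b} → a ≡ true → a ∨ b ≡ true
∨-trueˡ refl = refl

addEdge-inv : (A : Graph N) (a b x y : Fin N) → addEdge A a b x y ≡ true → A x y ≡ true ⊎ SameEdge a b x y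
addEdge-inv A a b x y h = map₂ (witness (sameEdge? a b x y)) (∨-true {A x y} h)

addEdge-new : (A : Graph N) (a b x y : Fin N) → SameEdge a b x y → addEdge A a b x y ≡ true
addEdge-new A a b x y e = ∨-trueʳ {A x y} (dec-true (sameEdge? a b x y) e)

addEdge-old : (A : Graph N) (a b x y : Fin N) → A x y ≡ true → addEdge A a b x y ≡ true
addEdge-old A a b x y = ∨-trueˡ

addEdge-sym : (A : Graph N) (a b : Fin N) → Symmetric A → Symmetric (addEdge A a b)
addEdge-sym A a b sA x y h with addEdge-inv A a b x y h
... | inj₁ xy = addEdge-old A a b y x (sA x y xy)
... | inj₂ e  = addEdge-new A a b y x (sameEdge-flip e)

pathGraph-sym : ∀ k → Symmetric (pathGraph k)
pathGraph-sym k i j h = trans (𝔹.∨-comm (does (toℕ i ℕ.≟ suc (toℕ j))) _) h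

pathGraph-step : (t : Fin l) → pathGraph (suc l) (inject₁ t) (suc t) ≡ true
pathGraph-step t rewrite toℕ-inject₁ t | dec-true (toℕ t ℕ.≟ toℕ t) refl = refl

toℕ-suc⇒inject₁ : (i : Fin (suc l)) (t : Fin l) → does (toℕ (suc t) ℕ.≟ suc (toℕ i)) ≡ true → i ≡ inject₁ t
toℕ-suc⇒inject₁ i t e = toℕ-injective
  (trans (ℕₚ.suc-injective (sym (witness (toℕ (suc t) ℕ.≟ suc (toℕ i)) e))) (sym (toℕ-inject₁ t)))

pathGraph-inv : (i j : Fin (suc l)) → pathGraph (suc l) i j ≡ true → ∃ λ t → SameEdge (inject₁ t) (suc t) i j
pathGraph-inv i j h with ∨-true {does (toℕ j ℕ.≟ suc (toℕ i))} h
pathGraph-inv i zero h    | inj₁ e = contradiction (witness (0 ℕ.≟ suc (toℕ i)) e) λ ()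
pathGraph-inv i (suc t) h | inj₁ e = t , inj₁ (toℕ-suc⇒inject₁ i t e , refl)
pathGraph-inv zero j h    | inj₂ e = contradiction (witness (0 ℕ.≟ suc (toℕ j)) e) λ ()
pathGraph-inv (suc t) j h | inj₂ e = t , inj₂ (refl , toℕ-suc⇒inject₁ j t e)

pathGraph-hom : {H : Graph N} → Symmetric H → (φ : Fin (suc l) → Fin N) →
  (∀ t → H (φ (inject₁ t)) (φ (suc t)) ≡ true) → ∀ i j → pathGraph (suc l) i j ≡ true → H (φ i) (φ j) ≡ true
pathGraph-hom sH φ steps i j h with pathGraph-inv i j h
... | t , inj₁ (refl , refl) = steps t
... | t , inj₂ (refl , refl) = sH _ _ (steps t)

chain-const : (g : Fin (suc l) → X) → (∀ s → g (inject₁ s) ≡ g (suc s)) → ∀ i j → g i ≡ g j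
chain-const g steps i j = trans (sym (chain g steps i)) (chain g steps j)

pathGraph-conn : ∀ l → Connected (pathGraph (suc l))
pathGraph-conn l g cg = chain-const g λ s → cg _ _ (pathGraph-step s)

simple-sym : {H : Graph N} → IsSimple H → Symmetric H
simple-sym sH u v h = trans (IsSimple.sym sH v u) h

-- A connected graph with at most `N` edges has at most one cycle. Here the pan contains it, so
-- every edge elsewhere is a bridge.
pan-bridged : ∀ {H : Graph N} {m} (φ : Fin (4 + m) → Fin N) → IsSimple H → Connected H → edges H ≤ N → Inj φ →
  (∀ t → H (φ (inject₁ t)) (φ (suc t)) ≡ true) → H (φ (suc zero)) (φ (fromℕ (3 + m))) ≡ true →
  Bridged H (pan (suc m)) φ
pan-bridged {N} {H} {m} φ sH conn few inj steps chord = record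
  { S-sym  = addEdge-sym P c d (pathGraph-sym _)
  ; S-conn = λ g cg → pathGraph-conn _ g λ i j h → cg i j (addEdge-old P c d i j h)
  ; φ-inj  = inj
  ; φ-hom  = λ i j h → hom i j (addEdge-inv P c d i j h)
  ; H-conn = conn
  ; bridge = bridge
  }
  where
  P = pathGraph (4 + m)
  c d : Fin (4 + m)
  c = suc zero
  d = fromℕ (3 + m)
  hom : ∀ i j → P i j ≡ true ⊎ SameEdge c d i j → H (φ i) (φ j) ≡ true
  hom i j (inj₁ h) = pathGraph-hom (simple-sym sH) φ steps i j h
  hom _ _ (inj₂ (inj₁ (refl , refl))) = chord
  hom _ _ (inj₂ (inj₂ (refl , refl))) = simple-sym sH _ _ chord
  step-≢-chord : ∀ t → ¬ SameEdge (φ c) (φ d) (φ (inject₁ t)) (φ (suc t))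
  step-≢-chord t (inj₂ (e , _)) = fromℕ≢inject₁ (inj (sym e))
  step-≢-chord zero (inj₁ (e , _)) = case inj e of λ ()
  step-≢-chord (suc zero) (inj₁ (_ , e)) = case inj e of λ ()
  step-≢-chord (suc (suc t)) (inj₁ (e , _)) = case inj e of λ ()
  -- Otherwise the chord could be removed too, leaving a connected graph with fewer than N - 1 edges.
  bridge : ∀ a b → H a b ≡ true → ¬ Image (pan (suc m)) φ a b → ¬ Connected (delete H a b)
  bridge a b h outside conn' = ℕₚ.<-irrefl refl (begin-strict
    N                     ≤⟨ connected⇒≤ (delete-simple _ _ s') conn'' ⟩
    suc (edges H'')       ≡⟨ sym (edges-delete s' chord') ⟩
    edges H'              <⟨ ℕₚ.n<1+n _ ⟩
    suc (edges H')        ≡⟨ sym (edges-delete sH h) ⟩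
    edges H               ≤⟨ few ⟩
    N                     ∎)
    where
    open ℕₚ.≤-Reasoning
    H' H'' : Graph N
    H' = delete H a b
    H'' = delete H' (φ c) (φ d)
    s' : IsSimple H'
    s' = delete-simple a b sH
    inside : ∀ i j → addEdge P c d i j ≡ true → ¬ SameEdge a b (φ i) (φ j)
    inside i j ij (inj₁ (e , e')) = outside (i , j , e , e' , ij)
    inside i j ij (inj₂ (e , e')) = outside (j , i , e' , e , addEdge-sym P c d (pathGraph-sym _) i j ij)
    chord' : H' (φ c) (φ d) ≡ true
    chord' = delete-keep {A = H} chord (inside c d (addEdge-new P c d c d (inj₁ (refl , refl))))
    conn'' : Connected H''
    -- The path along `φ` avoids both deleted edges and still joins the ends of the chord.
    conn'' = connected-delete {A = H'} conn' λ f cf → chain-const (f ∘ φ) (λ t → cf _ _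
      (delete-keep {A = H'} (delete-keep {A = H} (steps t)
        (inside (inject₁ t) (suc t) (addEdge-old P c d (inject₁ t) (suc t) (pathGraph-step t)))) (step-≢-chord t))) c d

-- With fewer than `N` edges, deleting any edge leaves too few to be connected.
path-bridged : ∀ {H : Graph N} (φ : Fin (suc l) → Fin N) → IsSimple H → Connected H → edges H < N → Inj φ →
  (∀ t → H (φ (inject₁ t)) (φ (suc t)) ≡ true) → Bridged H (pathGraph (suc l)) φ
path-bridged {H = H} φ sH conn few inj steps = record
  { S-sym  = pathGraph-sym _
  ; S-conn = pathGraph-conn _
  ; φ-inj  = inj
  ; φ-hom  = pathGraph-hom (simple-sym sH) φ steps
  ; H-conn = conn
  ; bridge = λ a b h _ conn' → ℕₚ.<-irrefl refl (ℕₚ.<-≤-trans few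
      (ℕₚ.≤-trans (connected⇒≤ (delete-simple a b sH) conn') (ℕₚ.≤-reflexive (sym (edges-delete sH h)))))
  }

-- Pentagons

next : Fin 5 → Fin 5
next zero                         = suc zero
next (suc zero)                   = suc (suc zero)
next (suc (suc zero))             = suc (suc (suc zero))
next (suc (suc (suc zero)))       = suc (suc (suc (suc zero)))
next (suc (suc (suc (suc zero)))) = zero

C5-next : ∀ i → C5 i (next i) ≡ true
C5-next = from-yes (all? λ i → C5 i (next i) 𝔹.≟ true)

C5-inv : ∀ i j → C5 i j ≡ true → j ≡ next i ⊎ i ≡ next j
C5-inv = from-yes (all? λ i → all? λ j → (C5 i j 𝔹.≟ true) →-dec ((j ≟ next i) ⊎-dec (i ≟ next j)))

C5-hom : {H : Graph N} → Symmetric H → (f : Fin 5 → Fin N) → (∀ i → H (f i) (f (next i)) ≡ true) →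
         ∀ i j → C5 i j ≡ true → H (f i) (f j) ≡ true
C5-hom sH f h i j ij with C5-inv i j ij
... | inj₁ refl = h i
... | inj₂ refl = sH _ _ (h j)

-- The pentagon listed from `next i` round to `i`: a path through all its edges except the one
-- joining `i` and `next i`.
rotate : Fin 5 → Fin 5 → Fin 5
rotate i t = iterate next (next i) (toℕ t)

rotate-inj : ∀ i s t → rotate i s ≡ rotate i t → s ≡ t
rotate-inj = from-yes (all? λ i → all? λ s → all? λ t → (rotate i s ≟ rotate i t) →-dec (s ≟ t))

rotate-last : ∀ i → rotate i (fromℕ 4) ≡ i
rotate-last = from-yes (all? λ i → rotate i (fromℕ 4) ≟ i)

rotate-suc : ∀ i (t : Fin 4) → rotate i (suc t) ≡ next (rotate i (inject₁ t))
rotate-suc = from-yes (all? λ i → all? λ (t : Fin 4) → rotate i (suc t) ≟ next (rotate i (inject₁ t)))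

rotate-≢ : ∀ i (t : Fin 4) → rotate i (inject₁ t) ≢ i
rotate-≢ = from-yes (all? λ i → all? λ (t : Fin 4) → ¬? (rotate i (inject₁ t) ≟ i))

next²-≢ : ∀ i → next (next i) ≢ i
next²-≢ = from-yes (all? λ i → ¬? (next (next i) ≟ i))

sameEdge-trans : {a b x y x' y' : Fin N} → SameEdge a b x y → SameEdge a b x' y' → SameEdge x y x' y'
sameEdge-trans (inj₁ (refl , refl)) e = e
sameEdge-trans (inj₂ (refl , refl)) e = sameEdge-swap e

path-reverse : ∀ {H : Graph N} {u v} → Symmetric H → Path H 4 u v → Path H 4 v u
path-reverse sH P = record
  { at = at ∘ opposite ; inj = λ {s} {t} e → opposite-inj s t (inj e) ; first = last ; last = first
  ; step = λ { zero → sH _ _ (step (suc (suc (suc zero)))) ; (suc zero) → sH _ _ (step (suc (suc zero)))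
             ; (suc (suc zero)) → sH _ _ (step (suc zero)) ; (suc (suc (suc zero))) → sH _ _ (step zero) } }
  where
  open Path P
  opposite-inj : ∀ (s t : Fin 5) → opposite s ≡ opposite t → s ≡ t
  opposite-inj = from-yes (all? λ (s : Fin 5) → all? λ t → (opposite s ≟ opposite t) →-dec (s ≟ t))

-- Some edge of the new pentagon is missing from `H`, hence is the added edge; the other four form
-- the path.
new-C5⇒path : {H : Graph N} → Symmetric H → ¬ ContainsCopy C5 H → ∀ u v → ContainsCopy C5 (addEdge H u v) → Path H 4 u v
new-C5⇒path {N} {H} sH free u v (f , f-inj , f-hom) with all? (λ i → H (f i) (f (next i)) 𝔹.≟ true)
... | yes old = contradiction (f , (λ {_} {_} → f-inj) , C5-hom sH f old) free
... | no ¬old = orient (new (proj₁ missing) (proj₂ missing))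
  where
  missing : ∃ λ i → H (f i) (f (next i)) ≢ true
  missing = ¬∀⟶∃¬ 5 _ (λ i → H (f i) (f (next i)) 𝔹.≟ true) ¬old
  i = proj₁ missing
  new : ∀ j → H (f j) (f (next j)) ≢ true → SameEdge u v (f j) (f (next j))
  new j h with addEdge-inv H u v (f j) (f (next j)) (f-hom j (next j) (C5-next j))
  ... | inj₁ old = contradiction old h
  ... | inj₂ e   = e
  P : Path H 4 (f (next i)) (f i)
  P = record
    { at = f ∘ rotate i ; inj = λ {s} {t} e → rotate-inj i s t (f-inj e) ; first = refl ; last = cong f (rotate-last i)
    -- A second missing edge would also be the added one, so it would coincide with the edge at `i`,
    -- in one direction or the other.
    ; step = λ t → decidable-stable (_ 𝔹.≟ true) λ h →
        let x = rotate i (inject₁ t) in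
        case sameEdge-trans (new i (proj₂ missing)) (new x (h ∘ trans (cong (λ y → H (f x) (f y)) (rotate-suc i t)))) of λ
          { (inj₁ (e , _)) → rotate-≢ i t (f-inj e)
          ; (inj₂ (e , e')) → next²-≢ i (trans (cong next (sym (f-inj e))) (f-inj e')) } }
  orient : SameEdge u v (f i) (f (next i)) → Path H 4 u v
  orient (inj₁ (refl , refl)) = path-reverse sH P
  orient (inj₂ (refl , refl)) = P

-- The lower bound

part : Fin (3 * n) → Fin 3
part {n} = quotient {3} n

K3-true : {u v : Fin (3 * n)} → part {n} u ≢ part {n} v → K3 n u v ≡ true
K3-true {n} {u} {v} ne rewrite dec-false (part {n} u ≟ part {n} v) ne = refl

K3-≢ : {u v : Fin (3 * n)} → K3 n u v ≡ true → part {n} u ≢ part {n} v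
K3-≢ {n} {u} {v} h e rewrite dec-true (part {n} u ≟ part {n} v) e = contradiction h λ ()

∷-inj : {x : Fin N} {f : Fin l → Fin N} → (∀ i → x ≢ f i) → Inj f → Inj (x ∷ᵛ f)
∷-inj x∉ inj {zero}  {zero}  e = refl
∷-inj x∉ inj {zero}  {suc j} e = contradiction e (x∉ j)
∷-inj x∉ inj {suc i} {zero}  e = contradiction (sym e) (x∉ i)
∷-inj x∉ inj {suc i} {suc j} e = cong suc (inj e)

-- Cycles

previous : Fin (suc l) → Fin (suc l)
previous {l} zero = fromℕ l
previous (suc i)  = inject₁ i

previous-inj : Inj (previous {l})
previous-inj {x = zero}  {zero}  e = refl
previous-inj {x = zero}  {suc j} e = contradiction e fromℕ≢inject₁
previous-inj {x = suc i} {zero}  e = contradiction (sym e) fromℕ≢inject₁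
previous-inj {x = suc i} {suc j} e = cong suc (inject₁-injective e)

record Cycle (H : Graph N) (c : Fin (suc l) → Fin N) : Set where
  field
    inj  : Inj c
    step : ∀ i → H (c i) (c (previous i)) ≡ true

cycle-rotate : {H : Graph N} {c : Fin (suc l) → Fin N} → Cycle H c → Cycle H (c ∘ previous)
cycle-rotate C = record { inj = previous-inj ∘ Cycle.inj C ; step = Cycle.step C ∘ previous }

-- Without a pendant neighbour anywhere, the vertices of the cycle are closed under adjacency, so by
-- connectedness they are all vertices.
cycle-spans : {H : Graph N} → Symmetric H → Connected H →
  (∀ (c : Fin (suc l) → Fin N) → Cycle H c → ∀ x → (∀ i → x ≢ c i) → ¬ H x (c zero) ≡ true) →
  (c : Fin (suc l) → Fin N) → Cycle H c → N ≤ suc l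
cycle-spans {N} {l} {H} sH conn no-pendant c C = injective⇒≤ {f = proj₁ ∘ on} λ {u} {v} e →
  trans (sym (proj₂ (on u))) (trans (cong c e) (proj₂ (on v)))
  where
  On : Fin N → Set
  On w = ∃ λ i → c i ≡ w
  on? : ∀ w → Dec (On w)
  on? w = any? λ i → c i ≟ w
  NoPendantAt : Fin (suc l) → Set
  NoPendantAt i = ∀ c → Cycle H c → ∀ x → (∀ i → x ≢ c i) → ¬ H x (c i) ≡ true
  no-pendant-at : ∀ i → NoPendantAt i
  -- Rotation moves the vertex at the last position to position 0 and the one at `inject₁ i` to
  -- `suc i`, hence an induction downwards from the last position.
  no-pendant-at = >-weakInduction NoPendantAt
    (λ c C x x∉ → no-pendant (c ∘ previous) (cycle-rotate C) x (x∉ ∘ previous))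
    (λ i ih c C x x∉ → ih (c ∘ previous) (cycle-rotate C) x (x∉ ∘ previous))
  closed : ∀ u v → H u v ≡ true → On u → On v
  closed u v h (i , refl) = decidable-stable (on? v) λ off →
    no-pendant-at i c C v (λ j e → off (j , sym e)) (sH _ _ h)
  on : ∀ w → On w
  on w = witness (on? w) (trans
    -- Lying on the cycle is a Boolean label constant along edges, and it is true at `c zero`.
    (conn (does ∘ on?) (λ u v h → does-⇔ (mk⇔ (closed u v h) (closed v u (sH u v h))) (on? u) (on? v)) w (c zero))
    (dec-true (on? (c zero)) (zero , refl)))

-- Saturated graphs: connectedness and forced coincidences of parts

module Sat {n-1 : ℕ} {H : Graph (3 * suc n-1)} (S : Saturated (K3 (suc n-1)) C5 H) where
  open Saturated S

  n' : ℕ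
  n' = suc n-1

  V : Set
  V = Fin (3 * n')

  col : V → Fin 3
  col = part {n'}

  H-sym : Symmetric H
  H-sym = simple-sym simple

  adj⇒≢ : ∀ {u v} → H u v ≡ true → col u ≢ col v
  adj⇒≢ {u} {v} h = K3-≢ {n'} {u} {v} (spanning u v h)

  path : ∀ u v → col u ≢ col v → H u v ≡ false → Path H 4 u v
  path u v ne h = new-C5⇒path H-sym free u v (maximal u v (K3-true {n'} {u} {v} ne) h)

  vertex : Fin 3 → V
  vertex p = combine p zero

  col-vertex : ∀ p → col (vertex p) ≡ p
  col-vertex p = cong proj₁ (remQuot-combine {3} {n'} p zero)

  across : (f : V → X) → Compatible H f → ∀ u v → col u ≢ col v → f u ≡ f v
  across f cf u v ne with H u v in h
  ... | true = cf u v h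
  ... | false = trans (cong f (sym first)) (trans (chain (f ∘ at) (λ s → cf _ _ (step s)) (fromℕ 4)) (cong f last))
    where open Path (path u v ne h)

  other : ∀ p → ∃ λ (q : Fin 3) → p ≢ q
  other = from-yes (all? λ (p : Fin 3) → any? λ q → ¬? (p ≟ q))

  -- Two vertices of one part are compared through a vertex of another part.
  conn : Connected H
  conn f cf u v with col u ≟ col v
  ... | no ne = across f cf u v ne
  ... | yes e with q , p≢q ← other (col u) =
    trans (across f cf u (vertex q) λ e' → p≢q (trans e' (col-vertex q)))
          (sym (across f cf v (vertex q) λ e' → p≢q (trans e (trans e' (col-vertex q)))))

  -- In different parts, the two vertices would be joined in `H` by an edge or a path of length 4,
  -- which is confined to `S`.
  same-part : {S : Graph k} {φ : Fin k → V} → Bridged H S φ →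
              ∀ i j → i ≢ j → S i j ≡ false → ¬ ShortPath S i j → col (φ i) ≡ col (φ j)
  same-part {φ = φ} B i j i≢j Sij none = decidable-stable (col (φ i) ≟ col (φ j)) different
    where
    open Bridged B
    different : ¬ col (φ i) ≢ col (φ j)
    different ne with H (φ i) (φ j) in h
    ... | true  = true≢false (trans (sym (confined-edge i j i≢j h)) Sij)
    ... | false = none (confined-path i j (path (φ i) (φ j) ne h))

  Sees : Fin 3 → V → Set
  Sees c w = col w ≡ c ⊎ ∃ λ v → H w v ≡ true × col v ≡ c

  sees? : ∀ c w → Dec (Sees c w)
  sees? c w = (col w ≟ c) ⊎-dec any? λ v → (H w v 𝔹.≟ true) ×-dec (col v ≟ c)

  Monochrome : Set
  Monochrome = ∀ x y z → H y x ≡ true → H y z ≡ true → col x ≡ col z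

  -- If `u` sees `c` through a neighbour `w`, then `v` and `w` are both neighbours of `u`, so `v`
  -- itself has colour `c`.
  sees-step : Monochrome → ∀ c u v → H u v ≡ true → Sees c u → Sees c v
  sees-step mono c u v h (inj₁ e)            = inj₂ (u , H-sym u v h , e)
  sees-step mono c u v h (inj₂ (w , uw , e)) = inj₁ (trans (mono v u w h uw) e)

  sees : Monochrome → ∀ c w → Sees c w
  sees mono c w = witness (sees? c w) (trans
    (conn (does ∘ sees? c) (λ u v h → does-⇔ (mk⇔ (sees-step mono c u v h) (sees-step mono c v u (H-sym u v h)))
       (sees? c u) (sees? c v)) w (vertex c))
    (dec-true (sees? c (vertex c)) (inj₁ (col-vertex c))))

  -- If all neighbours of each vertex had the same colour, a vertex of colour 2 could not see both other colours.
  ¬monochrome : ¬ Monochrome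
  ¬monochrome mono with sees mono zero (vertex (suc (suc zero))) | sees mono (suc zero) (vertex (suc (suc zero)))
  ... | inj₁ e | _ = case trans (sym (col-vertex (suc (suc zero)))) e of λ ()
  ... | inj₂ _ | inj₁ e = case trans (sym (col-vertex (suc (suc zero)))) e of λ ()
  ... | inj₂ (x , yx , ex) | inj₂ (z , yz , ez) = case trans (sym ex) (trans (mono x _ z yx yz) ez) of λ ()

  module _ {x y z : V} (yx : H y x ≡ true) (yz : H y z ≡ true) (x≢z : col x ≢ col z) where

    y≢x : y ≢ x
    y≢x refl = adj⇒≢ yx refl

    y≢z : y ≢ z
    y≢z refl = adj⇒≢ yz refl

    cherry : Fin 3 → V
    cherry = x ∷ᵛ y ∷ᵛ z ∷ᵛ []ᵛ

    cherry-inj : Inj cherry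
    cherry-inj = ∷-inj (λ { zero → y≢x ∘ sym ; (suc zero) → x≢z ∘ cong col })
                   (∷-inj (λ { zero → y≢z }) (∷-inj {f = []ᵛ} (λ ()) λ { {()} }))

    -- The path `x y z` joins its ends by no edge, and three vertices leave no room for a path of
    -- length 4, so `x` and `z` would share a part.
    ¬<N : ¬ edges H < 3 * n'
    ¬<N few = x≢z (same-part (path-bridged cherry simple conn few cherry-inj λ { zero → H-sym _ _ yx ; (suc zero) → yz })
                zero (suc (suc zero)) (λ ()) refl (from-no (shortPath? (pathGraph 3) zero (suc (suc zero)))))

  N≤edges : 3 * n' ≤ edges H
  N≤edges = ℕₚ.≮⇒≥ λ few → ¬monochrome λ x y z yx yz → decidable-stable (col x ≟ col z) λ ne → ¬<N yx yz ne few

  module _ (few : edges H ≤ 3 * n') where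

    module _ {m} (φ : Fin (4 + m) → V) (inj : Inj φ) (steps : ∀ t → H (φ (inject₁ t)) (φ (suc t)) ≡ true)
             (chord : H (φ (suc zero)) (φ (fromℕ (3 + m))) ≡ true) where

      pan-part : ∀ i j → i ≢ j → pan (suc m) i j ≡ false → ¬ ShortPath (pan (suc m)) i j → col (φ i) ≡ col (φ j)
      pan-part = same-part (pan-bridged φ simple conn few inj steps chord)

    -- The pendant vertex 0 forces its colour on 2 and 3, which are adjacent.
    no-3-pan : (φ : Fin 4 → V) → Inj φ → (∀ t → H (φ (inject₁ t)) (φ (suc t)) ≡ true) → ¬ H (φ 1′) (φ 3′) ≡ true
    no-3-pan φ inj steps chord = adj⇒≢ (steps 2′) (trans
      (sym (pan-part φ inj steps chord 0′ 2′ (λ ()) refl (from-no (shortPath? (pan 1) 0′ 2′))))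
      (pan-part φ inj steps chord 0′ 3′ (λ ()) refl (from-no (shortPath? (pan 1) 0′ 3′))))

    -- Vertex 3, opposite to the attachment vertex 1, shares its colour with both 0 and 1, which are
    -- adjacent.
    no-4-pan : (φ : Fin 5 → V) → Inj φ → (∀ t → H (φ (inject₁ t)) (φ (suc t)) ≡ true) → ¬ H (φ 1′) (φ 4′) ≡ true
    no-4-pan φ inj steps chord = adj⇒≢ (steps 0′) (trans
      (pan-part φ inj steps chord 0′ 3′ (λ ()) refl (from-no (shortPath? (pan 2) 0′ 3′)))
      (sym (pan-part φ inj steps chord 1′ 3′ (λ ()) refl (from-no (shortPath? (pan 2) 1′ 3′)))))

    -- Colours agree at 0 and 2, at the opposite vertices 2 and 5, and at 0 and 6; but 5 and 6 are
    -- adjacent.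
    no-6-pan : (φ : Fin 7 → V) → Inj φ → (∀ t → H (φ (inject₁ t)) (φ (suc t)) ≡ true) → ¬ H (φ 1′) (φ 6′) ≡ true
    no-6-pan φ inj steps chord = adj⇒≢ (steps 5′) (trans
      (sym (trans (pan-part φ inj steps chord 0′ 2′ (λ ()) refl (from-no (shortPath? (pan 4) 0′ 2′)))
                  (pan-part φ inj steps chord 2′ 5′ (λ ()) refl (from-no (shortPath? (pan 4) 2′ 5′)))))
      (pan-part φ inj steps chord 0′ 6′ (λ ()) refl (from-no (shortPath? (pan 4) 0′ 6′))))

    pendant : {c : Fin (3 + m) → V} → Cycle H c → ∀ {x} → (∀ i → x ≢ c i) → H x (c zero) ≡ true →
      (¬pan : ∀ (φ : Fin (4 + m) → V) → Inj φ → (∀ t → H (φ (inject₁ t)) (φ (suc t)) ≡ true) →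
              ¬ H (φ 1′) (φ (fromℕ (3 + m))) ≡ true) → ⊥
    pendant {c = c} C {x} x∉ h ¬pan = ¬pan (x ∷ᵛ c) (∷-inj x∉ (Cycle.inj C))
      (λ { zero → h ; (suc s) → H-sym _ _ (Cycle.step C (suc s)) }) (Cycle.step C zero)

    3-cycle-spans : (c : Fin 3 → V) → Cycle H c → 3 * n' ≤ 3
    3-cycle-spans = cycle-spans H-sym conn λ c C x x∉ h → pendant C x∉ h no-3-pan

    6-cycle-spans : (c : Fin 6 → V) → Cycle H c → 3 * n' ≤ 6
    6-cycle-spans = cycle-spans H-sym conn λ c C x x∉ h → pendant C x∉ h no-6-pan

    cherry⇒small : ∀ x y z → H y x ≡ true → H y z ≡ true → col x ≢ col z → 3 * n' ≤ 6
    cherry⇒small x y z yx yz x≢z with H x z in xz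
    ... | true = ℕₚ.≤-trans (3-cycle-spans (cherry yx yz x≢z) record
      { inj = cherry-inj yx yz x≢z
      ; step = λ { zero → xz ; (suc zero) → yx ; (suc (suc zero)) → H-sym _ _ yz } }) (from-yes (3 ≤? 6))
    ... | false with path x z x≢z xz
    ... | record { at = at ; inj = inj ; first = refl ; last = refl ; step = step } with any? (λ i → y ≟ at i)
    -- Off the path, `y` closes it to a hexagon.
    ... | no y∉ = 6-cycle-spans (y ∷ᵛ at) record
      { inj = ∷-inj (λ i e → y∉ (i , e)) inj
      ; step = λ { zero → yz ; (suc zero) → H-sym _ _ yx ; (suc (suc i)) → H-sym _ _ (step i) } }
    ... | yes (0′ , refl) = contradiction refl (y≢x yx yz x≢z)
    -- The edge `yz` closes the last four path vertices to a 4-cycle, with `x` pendant at `y`.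
    ... | yes (1′ , refl) = contradiction yz (no-4-pan at inj step)
    -- A triangle `y`, `x`, `at 1′` with `z` pendant at `y`; `τ` lists these vertices in the order
    -- of the pan.
    ... | yes (2′ , refl) = contradiction (H-sym _ _ (step 1′)) (no-3-pan (at ∘ τ) (λ {s} {t} e → τ-inj s t (inj e))
      λ { 0′ → H-sym _ _ yz ; 1′ → yx ; 2′ → step 0′ })
      where
      τ : Fin 4 → Fin 5
      τ = 4′ ∷ᵛ 2′ ∷ᵛ 0′ ∷ᵛ 1′ ∷ᵛ []ᵛ
      τ-inj : ∀ s t → τ s ≡ τ t → s ≡ t
      τ-inj = from-yes (all? λ s → all? λ t → (τ s ≟ τ t) →-dec (s ≟ t))
    -- The mirror image of the case `1′`.
    ... | yes (3′ , refl) = contradiction yx (no-4-pan (Path.at P) (Path.inj P) (Path.step P))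
      where
      P : Path H 4 (at 4′) (at 0′)
      P = path-reverse H-sym record { at = at ; inj = inj ; first = refl ; last = refl ; step = step }
    ... | yes (4′ , refl) = contradiction refl (y≢z yx yz x≢z)

  N<edges : 3 ≤ n' → 3 * n' < edges H
  N<edges 3≤n = ℕₚ.≰⇒> λ few → ¬monochrome λ x y z yx yz → decidable-stable (col x ≟ col z) λ ne →
    ℕₚ.<⇒≱ (ℕₚ.<-≤-trans (from-yes (6 ℕ.<? 9)) (ℕₚ.*-monoʳ-≤ 3 3≤n)) (cherry⇒small few x y z yx yz ne)

-- Constructions

sum-zero : {A : Set} (f : A → ℕ) → (∀ x → f x ≡ 0) → ∀ xs → sum (map f xs) ≡ 0
sum-zero f h []       = refl
sum-zero f h (x ∷ xs) = cong₂ _+_ (h x) (sum-zero f h xs)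

edges-none : {A : Graph N} → (∀ u v → A u v ≡ false) → edges A ≡ 0
edges-none none = sum-zero _ (λ u → sum-zero _ (λ v →
  cong (if_then 1 else 0) (trans (cong (does (u <? v) ∧_) (none u v)) (𝔹.∧-zeroʳ _))) (allFin _)) (allFin _)

-- Each entry of `L` removes at most one edge; repetitions and non-edges in `L` are allowed.
edges-cover : (L : List (Fin N × Fin N)) {A : Graph N} → IsSimple A →
  (∀ u v → A u v ≡ true → Any (λ e → SameEdge (proj₁ e) (proj₂ e) u v) L) → edges A ≤ length L
edges-cover [] sA cover = ℕₚ.≤-reflexive (edges-none λ u v → ≢true⇒false λ uv → case cover u v uv of λ ())
edges-cover ((a , b) ∷ L) {A} sA cover with A a b in ab
... | true = ℕₚ.≤-trans (ℕₚ.≤-reflexive (edges-delete sA ab)) (s≤s (edges-cover L (delete-simple a b sA) cover'))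
  where
  cover' : ∀ u v → delete A a b u v ≡ true → Any (λ e → SameEdge (proj₁ e) (proj₂ e) u v) L
  cover' u v uv with cover u v (delete-⊆ {A = A} {a} {b} uv)
  ... | here e  = contradiction e (delete-≢ {A = A} uv)
  ... | there p = p
... | false = ℕₚ.m≤n⇒m≤1+n (edges-cover L sA cover')
  where
  cover' : ∀ u v → A u v ≡ true → Any (λ e → SameEdge (proj₁ e) (proj₂ e) u v) L
  cover' u v uv with cover u v uv
  ... | here (inj₁ (refl , refl)) = contradiction (trans (sym uv) ab) true≢false
  ... | here (inj₂ (refl , refl)) = contradiction (trans (sym uv) (trans (IsSimple.sym sA b a) ab)) true≢false
  ... | there p = p

-- Distinct vertices of a blow-up may lie over the same template vertex when that vertex is multiplied.
Apart : (Fin k → Bool) → Fin k → Fin k → Set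
Apart multiple a c = a ≢ c ⊎ multiple a ≡ true

apart? : (multiple : Fin k → Bool) → ∀ a c → Dec (Apart multiple a c)
apart? multiple a c = ¬? (a ≟ c) ⊎-dec (multiple a 𝔹.≟ true)

-- A pentagon in a blow-up projects to a closed walk `a b c d e` whose non-consecutive vertices are
-- `Apart`; this excludes such walks.
NoPentagon : Graph k → (Fin k → Bool) → Set
NoPentagon R multiple = ∀ a b → R a b ≡ true → ∀ c → R b c ≡ true → Apart multiple a c →
  ∀ d → R c d ≡ true → Apart multiple b d → ∀ e → R d e ≡ true → Apart multiple c e →
  R e a ≡ true → Apart multiple d a → ¬ Apart multiple e b

noPentagon? : (R : Graph k) (multiple : Fin k → Bool) → Dec (NoPentagon R multiple)
noPentagon? R multiple = all? λ a → all? λ b → (R a b 𝔹.≟ true) →-dec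
  all? λ c → (R b c 𝔹.≟ true) →-dec apart? multiple a c →-dec
  all? λ d → (R c d 𝔹.≟ true) →-dec apart? multiple b d →-dec
  all? λ e → (R d e 𝔹.≟ true) →-dec apart? multiple c e →-dec
  (R e a 𝔹.≟ true) →-dec apart? multiple d a →-dec ¬? (apart? multiple e b)

-- Finitely checkable conditions under which every blow-up that repeats only `multiple` vertices is
-- saturated.
record Template (k : ℕ) : Set where
  field
    R        : Graph k
    colour   : Fin k → Fin 3
    multiple : Fin k → Bool
    R-simple : IsSimple R
    proper   : ∀ i j → R i j ≡ true → colour i ≢ colour j
    no-C5    : NoPentagon R multiple
    short    : ∀ i j → colour i ≢ colour j → R i j ≡ false → ShortPath R i j

module BlowUp (T : Template k) {n : ℕ}
  (π : Fin (3 * n) → Fin k) (ι : Fin k → Fin (3 * n)) (π-ι : ∀ i → π (ι i) ≡ i)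
  (colour-π : ∀ u → Template.colour T (π u) ≡ part {n} u)
  (π-inj : ∀ u v → π u ≡ π v → u ≡ v ⊎ Template.multiple T (π u) ≡ true)
  where

  open Template T

  H : Graph (3 * n)
  H u v = R (π u) (π v)

  H-simple : IsSimple H
  H-simple = record { sym = λ u v → IsSimple.sym R-simple (π u) (π v) ; irrefl = λ u → IsSimple.irrefl R-simple (π u) }

  apart : ∀ {u v} → u ≢ v → Apart multiple (π u) (π v)
  apart {u} {v} ne with π u ≟ π v
  ... | no ne' = inj₁ ne'
  ... | yes e  = [ (λ u≡v → contradiction u≡v ne) , inj₂ ] (π-inj u v e)

  free : ¬ ContainsCopy C5 H
  free (f , inj , hom) = no-C5 (π (f 0′)) (π (f 1′)) (hom 0′ 1′ refl) (π (f 2′)) (hom 1′ 2′ refl) (far λ ())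
    (π (f 3′)) (hom 2′ 3′ refl) (far λ ()) (π (f 4′)) (hom 3′ 4′ refl) (far λ ()) (hom 4′ 0′ refl) (far λ ()) (far λ ())
    where
    far : ∀ {i j} → i ≢ j → Apart multiple (π (f i)) (π (f j))
    far ne = apart (ne ∘ inj)

  R⇒≢ : ∀ {i j} → R i j ≡ true → i ≢ j
  R⇒≢ h refl = proper _ _ h refl

  -- The ends `u` and `v` stay and `ι` lifts the three inner vertices. The projections are distinct,
  -- so the lifts are too, and the added edge closes the pentagon.
  lift : ∀ u v → π u ≢ π v → ShortPath R (π u) (π v) → ContainsCopy C5 (addEdge H u v)
  lift u v u≢v (a , ua , b , ab , u≢b , c , bc , u≢c , a≢c , cv , a≢v , b≢v) = f , (λ {_} {_} → f-inj) , C5-hom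
    (addEdge-sym H u v (simple-sym H-simple)) f λ
      { 0′ → addEdge-old H u v _ _ (subst (λ i → R (π u) i ≡ true) (sym (π-ι a)) ua)
      ; 1′ → addEdge-old H u v _ _ (over ab)
      ; 2′ → addEdge-old H u v _ _ (over bc)
      ; 3′ → addEdge-old H u v _ _ (subst (λ i → R i (π v) ≡ true) (sym (π-ι c)) cv)
      ; 4′ → addEdge-new H u v _ _ (inj₂ (refl , refl)) }
    where
    over : ∀ {i j} → R i j ≡ true → H (ι i) (ι j) ≡ true
    over {i} {j} h = trans (cong₂ R (π-ι i) (π-ι j)) h
    f : Fin 5 → Fin (3 * n)
    f = u ∷ᵛ ι a ∷ᵛ ι b ∷ᵛ ι c ∷ᵛ v ∷ᵛ []ᵛ
    g : Fin 5 → Fin k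
    g = π u ∷ᵛ a ∷ᵛ b ∷ᵛ c ∷ᵛ π v ∷ᵛ []ᵛ
    g-inj : Inj g
    g-inj = ∷-inj (λ { 0′ → R⇒≢ ua ; 1′ → u≢b ; 2′ → u≢c ; 3′ → u≢v })
            (∷-inj (λ { 0′ → R⇒≢ ab ; 1′ → a≢c ; 2′ → a≢v })
            (∷-inj (λ { 0′ → R⇒≢ bc ; 1′ → b≢v })
            (∷-inj (λ { 0′ → R⇒≢ cv }) (∷-inj {f = []ᵛ} (λ ()) λ { {()} }))))
    π-f : ∀ i → π (f i) ≡ g i
    π-f 0′ = refl
    π-f 1′ = π-ι a
    π-f 2′ = π-ι b
    π-f 3′ = π-ι c
    π-f 4′ = refl
    f-inj : Inj f
    f-inj {s} {t} e = g-inj (trans (sym (π-f s)) (trans (cong π e) (π-f t)))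

  saturated : Saturated (K3 n) C5 H
  saturated = record
    { simple = H-simple
    ; spanning = λ u v h → K3-true {n} λ e → proper _ _ h (trans (colour-π u) (trans e (sym (colour-π v))))
    ; free = free
    ; maximal = λ u v uv h →
        let ne = λ e → K3-≢ {n} uv (trans (sym (colour-π u)) (trans e (colour-π v)))
        in lift u v (ne ∘ cong colour) (short (π u) (π v) ne h)
    }

-- The templates for n = 2 and n ≥ 3

functional : (Fin k → Fin k) → Graph k
functional f i j = does (f i ≟ j) ∨ does (f j ≟ i)

-- The conditions are decided by evaluation, through the implicit `True` arguments.
template : (R : Graph k) (colour : Fin k → Fin 3) (multiple : Fin k → Bool)
  {_ : True (all? λ i → all? λ j → R i j 𝔹.≟ R j i)}
  {_ : True (all? λ i → all? λ j → (R i j 𝔹.≟ true) →-dec ¬? (colour i ≟ colour j))}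
  {_ : True (noPentagon? R multiple)}
  {_ : True (all? λ i → all? λ j → ¬? (colour i ≟ colour j) →-dec ((R i j 𝔹.≟ false) →-dec shortPath? R i j))} →
  Template k
template R colour multiple {symmetric} {proper} {no-C5} {short} = record
  { R = R ; colour = colour ; multiple = multiple
  ; R-simple = record { sym = toWitness symmetric
                      ; irrefl = λ u → ≢true⇒false λ h → toWitness proper u u h refl }
  ; proper = toWitness proper ; no-C5 = toWitness no-C5 ; short = toWitness short }

-- The hexagon 0 2 4 1 3 5 visits the three parts cyclically, so that opposite vertices lie in the same part.
hexagon : Template 6
hexagon = template (functional (2′ ∷ᵛ 3′ ∷ᵛ 4′ ∷ᵛ 5′ ∷ᵛ 1′ ∷ᵛ 0′ ∷ᵛ []ᵛ)) (part {2}) (λ _ → false)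

sat-2 : SatEq (K3 2) C5 6
sat-2 = (H , saturated , refl) , λ H S → Sat.N≤edges S
  where open BlowUp hexagon {2} id id (λ _ → refl) (λ _ → refl) (λ _ _ → inj₁)

-- With the extra edge 4 6: triangles 0 3 6 and 0 4 6, pendant vertices 2 at 6 and 7, 8 at 0, and the path 3 1 5.
parent : Fin 9 → Fin 9
parent = 3′ ∷ᵛ 3′ ∷ᵛ 6′ ∷ᵛ 6′ ∷ᵛ 0′ ∷ᵛ 1′ ∷ᵛ 0′ ∷ᵛ 0′ ∷ᵛ 0′ ∷ᵛ []ᵛ

-- The pendant vertices 2, 5, 8 are the ones repeated for larger n.
lastInPart : Fin 9 → Bool
lastInPart i = does (remainder {3} 3 i ≟ 2′)

diamond : Template 9
diamond = template (addEdge (functional parent) 4′ 6′) (part {3}) lastInPart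

-- No parent is repeated, so each vertex of the blow-up has a single edge to its parent.
parent-first : ∀ i → lastInPart (parent i) ≡ false
parent-first = from-yes (all? λ i → lastInPart (parent i) 𝔹.≟ false)

module _ (j : ℕ) where

  -- Positions from 2 on in a part all become copies of position 2, that is, of template vertex 2, 5
  -- or 8.
  cap : Fin (3 + j) → Fin 3
  cap 0′            = 0′
  cap 1′            = 1′
  cap (suc (suc _)) = 2′

  uncap : Fin 3 → Fin (3 + j)
  uncap 0′ = 0′
  uncap 1′ = 1′
  uncap 2′ = 2′

  cap-uncap : ∀ x → cap (uncap x) ≡ x
  cap-uncap 0′ = refl
  cap-uncap 1′ = refl
  cap-uncap 2′ = refl

  cap-inj : ∀ x y → cap x ≡ cap y → x ≡ y ⊎ cap x ≡ 2′
  cap-inj 0′            0′            e = inj₁ refl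
  cap-inj 1′            1′            e = inj₁ refl
  cap-inj (suc (suc x)) y             e = inj₂ refl
  cap-inj 0′            1′            ()
  cap-inj 0′            (suc (suc y)) ()
  cap-inj 1′            0′            ()
  cap-inj 1′            (suc (suc y)) ()

  rem : Fin (3 * (3 + j)) → Fin (3 + j)
  rem = remainder {3} (3 + j)

  π : Fin (3 * (3 + j)) → Fin 9
  π u = combine (part {3 + j} u) (cap (rem u))

  ι : Fin 9 → Fin (3 * (3 + j))
  ι i = combine (part {3} i) (uncap (remainder {3} 3 i))

  π-ι : ∀ i → π (ι i) ≡ i
  π-ι i = trans (cong₂ combine (cong proj₁ split) (trans (cong (cap ∘ proj₂) split) (cap-uncap _))) (combine-remQuot {3} 3 i)
    where
    split = remQuot-combine {3} {3 + j} (part {3} i) (uncap (remainder {3} 3 i))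

  remQuot-π : ∀ u → remQuot {3} 3 (π u) ≡ (part {3 + j} u , cap (rem u))
  remQuot-π u = remQuot-combine {3} {3} (part {3 + j} u) (cap (rem u))

  π-inj : ∀ u v → π u ≡ π v → u ≡ v ⊎ lastInPart (π u) ≡ true
  π-inj u v e with cap-inj (rem u) (rem v)
    (trans (sym (cong proj₂ (remQuot-π u))) (trans (cong (remainder {3} 3) e) (cong proj₂ (remQuot-π v))))
  ... | inj₁ same = inj₁ (trans (sym (combine-remQuot {3} (3 + j) u))
    (trans (cong₂ combine same-part same) (combine-remQuot {3} (3 + j) v)))
    where
    same-part : part {3 + j} u ≡ part {3 + j} v
    same-part = trans (sym (cong proj₁ (remQuot-π u))) (trans (cong (part {3}) e) (cong proj₁ (remQuot-π v)))
  ... | inj₂ e₂ = inj₂ (dec-true (_ ≟ 2′) (trans (cong proj₂ (remQuot-π u)) e₂))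

  open BlowUp diamond {3 + j} π ι π-ι (λ u → cong proj₁ (remQuot-π u)) π-inj

  ι-unique : ∀ v i → π v ≡ i → lastInPart i ≡ false → v ≡ ι i
  ι-unique v i refl first with π-inj v (ι (π v)) (sym (π-ι (π v)))
  ... | inj₁ e    = e
  ... | inj₂ last = contradiction (trans (sym last) first) true≢false

  -- One edge to the parent per vertex, and the extra edge of the diamond: 3n + 1 entries for n = 3
  -- + `j`.
  edgeList : List (Fin (3 * (3 + j)) × Fin (3 * (3 + j)))
  edgeList = (ι 4′ , ι 6′) ∷ map (λ u → u , ι (parent (π u))) (allFin (3 * (3 + j)))

  edgeList-length : length edgeList ≡ 3 * (3 + j) + 1
  edgeList-length = trans (cong suc (trans
    (length-map (λ u → u , ι (parent (π u))) (allFin (3 * (3 + j))))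
    (length-tabulate {n = 3 * (3 + j)} id))) (ℕₚ.+-comm 1 _)

  OnList : (u v : Fin (3 * (3 + j))) → Set
  OnList u v = Any (λ e → SameEdge (proj₁ e) (proj₂ e) u v) edgeList

  to-parent : ∀ u v → parent (π u) ≡ π v → v ≡ ι (parent (π u))
  to-parent u v e = ι-unique v (parent (π u)) (sym e) (parent-first (π u))

  covered : ∀ u v → H u v ≡ true → OnList u v
  covered u v h with addEdge-inv (functional parent) 4′ 6′ (π u) (π v) h
  ... | inj₂ (inj₁ (e , e')) = here (inj₁ (ι-unique u 4′ e refl , ι-unique v 6′ e' refl))
  ... | inj₂ (inj₂ (e , e')) = here (inj₂ (ι-unique u 6′ e refl , ι-unique v 4′ e' refl))
  ... | inj₁ uv with ∨-true {does (parent (π u) ≟ π v)} uv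
  ... | inj₁ e = there (map⁺ (lose (∈-allFin u) (inj₁ (refl , to-parent u v (witness (_ ≟ _) e)))))
  ... | inj₂ e = there (map⁺ (lose (∈-allFin v) (inj₂ (to-parent v u (witness (_ ≟ _) e) , refl))))

  sat-≥3 : SatEq (K3 (3 + j)) C5 (3 * (3 + j) + 1)
  -- The list bounds the edge count from above; the lower bound applied to `H` itself gives
  -- equality.
  sat-≥3 = (H , saturated , ℕₚ.≤-antisym
      (ℕₚ.≤-trans (edges-cover edgeList H-simple covered) (ℕₚ.≤-reflexive edgeList-length)) (lower H saturated)) , lower
    where
    lower : ∀ H → Saturated (K3 (3 + j)) C5 H → 3 * (3 + j) + 1 ≤ edges H
    lower H S = ℕₚ.≤-trans (ℕₚ.≤-reflexive (ℕₚ.+-comm _ 1)) (Sat.N<edges S (ℕₚ.m≤m+n 3 j))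

theorem1p6 : SatEq (K3 2) C5 6 × (∀ n → 3 ≤ n → SatEq (K3 n) C5 (3 * n + 1))
theorem1p6 = sat-2 , λ { _ (s≤s (s≤s (s≤s (z≤n {j})))) → sat-≥3 j }
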